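{- For any simple, undirected graph $G$ with $n$ vertices, $$\mathrm{irr}_t(G) \leq \frac{1}{12}\left(2n^3 - 3n^2 - 2n + 3\right).$$
   Context: All graphs are finite and undirected, without loops or multiple edges. For a graph $G$ and $u \in V(G)$, $d_G(u)$ denotes the degree of $u$. The total irregularity of $G$ is $\mathrm{irr}_t(G) = \frac{1}{2}\sum_{u,v \in V(G)} |d_G(u) - d_G(v)|$, where the sum is over all ordered pairs $(u,v)$ of vertices, so that each unordered pair of distinct vertices contributes $|d_G(u)-d_G(v)|$ exactly once. -}

module Defs where

open import Data.Fin.Base using (Fin)
open import Data.Fin.Subset using (Subset; ∣_∣)
open import Data.Integer.Base using (+_)
open import Data.Nat.Base using (ℕ; ∣_-_∣)
open import Data.Nat.Properties using (+-0-monoid)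
open import Data.Rational.Base using (ℚ; _/_)
open import Data.Vec.Base using (tabulate)
open import Level using (0ℓ)
open import Relation.Binary.Core using (Rel)
open import Relation.Binary.Definitions using (Decidable; Irreflexive; Symmetric)
open import Relation.Binary.PropositionalEquality.Core using (_≡_)
open import Relation.Nullary.Decidable.Core using (does)

open import Algebra.Properties.Monoid.Sum +-0-monoid using (sum-syntax)

-- Adjacency is a relation, so there are no multiple edges; its decidability,
-- automatic classically, is what makes degrees computable.
record Graph (n : ℕ) : Set₁ where
  field
    Adj    : Rel (Fin n) 0ℓ
    adj?   : Decidable Adj
    sym    : Symmetric Adj
    irrefl : Irreflexive _≡_ Adj

module _ {n : ℕ} (G : Graph n) where
  open Graph G

  neighbours : Fin n → Subset n
  neighbours u = tabulate (λ v → does (adj? u v))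

  degree : Fin n → ℕ
  degree u = ∣ neighbours u ∣

  -- The sum runs over ordered pairs, hence the division by 2.
  irrₜ : ℚ
  irrₜ = + (∑[ u < n ] ∑[ v < n ] ∣ degree u - degree v ∣) / 2

{-# OPTIONS --safe #-}

-- Order the vertices by decreasing degree d₀ ≥ d₁ ≥ ⋯ ≥ dₙ₋₁. Then
-- irrₜ G = ∑ᵢ (n − 1 − 2i) dᵢ, and distributing each degree over its edges turns
-- this into ∑ 2 (n − 1 − i − j) over the edges {i , j}. Keeping only the pairs
-- with a positive weight, whether or not they are edges, gives the upper bound
-- ∑_{i<j} 2 (n − 1 − i − j)⁺ = C(n+1, 3) − ⌊n²/4⌋, and ⌊n²/4⌋ ≥ (n² − 1)/4.
module Submission where

open import Defs

module Counting where
  open import Data.Bool.Base using (Bool; true; false; if_then_else_)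
  open import Data.Fin.Base using (Fin; zero; suc; toℕ) renaming (_≤_ to _≤ᶠ_)
  open import Data.Fin.Permutation using (Permutation′; _⟨$⟩ʳ_; id; transpose; lift₀; _∘ₚ_)
  open import Data.Fin.Subset using (∣_∣)
  open import Data.List.Base using (allFin)
  open import Data.List.Extrema.Nat using (argmax; f[xs]≤f[argmax])
  open import Data.List.Membership.Propositional.Properties using (∈-allFin)
  import Data.List.Relation.Unary.All as All
  open import Data.Nat.Base
  open import Data.Nat.Properties
  open import Data.Nat.Tactic.RingSolver using (solve-∀)
  open import Data.Product.Base using (∃; _,_)
  open import Data.Vec.Base using (tabulate)
  open import Function.Base using (_∘_; _∋_)
  open import Function.Bundles using (mk⇔)
  open import Relation.Binary.PropositionalEquality
  open import Relation.Nullary.Decidable using (does; dec-false; does-⇔)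
  open import Algebra.Properties.Semiring.Sum +-*-semiring

  -- Monotonicity of finite sums.

  sum-mono-≤ : ∀ {n} {f g : Fin n → ℕ} → (∀ i → f i ≤ g i) → sum f ≤ sum g
  sum-mono-≤ {zero}  f≤g = z≤n
  sum-mono-≤ {suc n} f≤g = +-mono-≤ (f≤g zero) (sum-mono-≤ (f≤g ∘ suc))

  -- One index is singled out because only the diagonal entry of a row will come with guaranteed
  -- slack.
  sum-mono-≤-gap : ∀ {n} {f g : Fin n → ℕ} {c} k → f k + c ≤ g k → (∀ i → f i ≤ g i) →
                   sum f + c ≤ sum g
  sum-mono-≤-gap {suc n} {f} {g} {c} zero gap f≤g = begin
    f zero + sum (f ∘ suc) + c    ≡⟨ ((∀ x y z → x + y + z ≡ x + z + y) ∋ solve-∀) (f zero) _ c ⟩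
    f zero + c + sum (f ∘ suc)    ≤⟨ +-mono-≤ gap (sum-mono-≤ (f≤g ∘ suc)) ⟩
    g zero + sum (g ∘ suc)        ∎
    where open ≤-Reasoning
  sum-mono-≤-gap {suc n} {f} {g} {c} (suc k) gap f≤g = begin
    f zero + sum (f ∘ suc) + c    ≡⟨ +-assoc (f zero) _ c ⟩
    f zero + (sum (f ∘ suc) + c)  ≤⟨ +-mono-≤ (f≤g zero) (sum-mono-≤-gap k gap (f≤g ∘ suc)) ⟩
    g zero + sum (g ∘ suc)        ∎
    where open ≤-Reasoning

  -- Sorting by a permutation.

  Antitone : ∀ {n} → (Fin n → ℕ) → Set
  Antitone e = ∀ {i j} → i ≤ᶠ j → e j ≤ e i

  maximum : ∀ {n} (f : Fin (suc n) → ℕ) → ∃ λ m → ∀ i → f i ≤ f m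
  maximum {n} f = argmax f zero (allFin (suc n)) ,
    λ i → All.lookup (f[xs]≤f[argmax] {f = f} zero (allFin (suc n))) (∈-allFin i)

  -- Selection sort: a transposition brings a maximum to the front and the tail is sorted
  -- recursively. `∘ₚ` applies its left factor first, so the tail is permuted before the
  -- transposition acts.
  sort : ∀ {n} (f : Fin n → ℕ) → ∃ λ (π : Permutation′ n) → Antitone (f ∘ (π ⟨$⟩ʳ_))
  sort {zero}  f = id , λ { {()} }
  sort {suc n} f with maximum f
  ... | m , f≤fm with sort (f ∘ (transpose zero m ⟨$⟩ʳ_) ∘ suc)
  ... | π , anti = lift₀ π ∘ₚ transpose zero m , sorted
    where
    sorted : Antitone (f ∘ (lift₀ π ∘ₚ transpose zero m ⟨$⟩ʳ_))
    sorted {zero}          _         = f≤fm _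
    sorted {suc _} {suc _} (s≤s i≤j) = anti i≤j

  -- Absolute differences in a decreasing sequence.

  -- ∑ ∣eᵢ − eⱼ∣ = 2 ∑ (n − 1 − 2i) eᵢ, with the negative terms moved to the left.
  sum-∣-∣-antitone : ∀ {n} (e : Fin n → ℕ) → Antitone e →
    ∑[ i < n ] ∑[ j < n ] ∣ e i - e j ∣ + 4 * ∑[ i < n ] (toℕ i * e i) + 2 * sum e ≡ 2 * (n * sum e)
  sum-∣-∣-antitone {zero}  e anti = refl
  sum-∣-∣-antitone {suc n} e anti = begin
    -- Induction by splitting off the largest term `x`: its row and its column each contribute `D`,
    -- and the index shift on the tail turns `W` into `E + W`.
    (∣ x - x ∣ + D) + ∑[ i < n ] (∣ e′ i - x ∣ + ∑[ j < n ] ∣ e′ i - e′ j ∣)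
      + 4 * ∑[ i < n ] (e′ i + toℕ i * e′ i) + 2 * (x + E)
      ≡⟨ cong₂ (λ a b → a + 4 * b + 2 * (x + E))
           (cong₂ (λ a b → a + D + b) (∣n-n∣≡0 x)
             (trans (∑-distrib-+ (λ i → ∣ e′ i - x ∣) _)
                    (cong (_+ S) (sum-cong-≗ (λ i → ∣-∣-comm (e′ i) x)))))
           (∑-distrib-+ e′ _) ⟩
    D + (D + S) + 4 * (E + W) + 2 * (x + E)
      ≡⟨ ((∀ D S E W x → D + (D + S) + 4 * (E + W) + 2 * (x + E)
            ≡ 2 * (D + E) + (S + 4 * W + 2 * E) + 2 * E + 2 * x) ∋ solve-∀) D S E W x ⟩
    2 * (D + E) + (S + 4 * W + 2 * E) + 2 * E + 2 * x
      ≡⟨ cong₂ (λ a b → 2 * a + b + 2 * E + 2 * x) D+E≡nx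
           (sum-∣-∣-antitone e′ (λ i≤j → anti (s≤s i≤j))) ⟩
    2 * (n * x) + 2 * (n * E) + 2 * E + 2 * x
      ≡⟨ ((∀ n x E → 2 * (n * x) + 2 * (n * E) + 2 * E + 2 * x
            ≡ 2 * ((1 + n) * (x + E))) ∋ solve-∀) n x E ⟩
    2 * (suc n * (x + E)) ∎
    where
    open ≡-Reasoning
    x = e zero
    e′ = e ∘ suc
    D = ∑[ j < n ] ∣ x - e′ j ∣
    E = sum e′
    W = ∑[ i < n ] (toℕ i * e′ i)
    S = ∑[ i < n ] ∑[ j < n ] ∣ e′ i - e′ j ∣
    sum-const : ∀ n → ∑[ _ < n ] x ≡ n * x
    sum-const zero    = refl
    sum-const (suc n) = cong (x +_) (sum-const n)
    -- As `x` is maximal, each absolute value is `x ∸ e′ j`, and adding `e′ j` restores `x`.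
    D+E≡nx : D + E ≡ n * x
    D+E≡nx = begin
      D + E                            ≡⟨ ∑-distrib-+ _ e′ ⟨
      ∑[ j < n ] (∣ x - e′ j ∣ + e′ j) ≡⟨ sum-cong-≗ (λ j →
        trans (cong (_+ e′ j) (m≤n⇒∣n-m∣≡n∸m (anti {zero} {suc j} z≤n)))
              (m∸n+n≡m (anti {zero} {suc j} z≤n))) ⟩
      ∑[ j < n ] x                     ≡⟨ sum-const n ⟩
      n * x                            ∎

  -- Weighted sums over a symmetric 0-1 matrix.

  -- Truncated subtraction supplies the positive part of the weight. The difference of the two sums
  -- is the total over ordered pairs with `i` and `j` distinct; the full square is easier to
  -- evaluate, row by row.
  square-sum diagonal-sum : ℕ → ℕ
  square-sum   n = ∑[ i < n ] ∑[ j < n ] (n ∸ suc (toℕ i + toℕ j))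
  diagonal-sum n = ∑[ i < n ] (n ∸ suc (toℕ i + toℕ i))

  module _ {n} (a : Fin n → Fin n → ℕ) (a≤1 : ∀ i j → a i j ≤ 1)
           (a-sym : ∀ i j → a i j ≡ a j i) (a-diag : ∀ i → a i i ≡ 0) where

    private
      row : Fin n → ℕ
      row i = ∑[ j < n ] a i j

      W : ℕ
      W = ∑[ i < n ] (toℕ i * row i)

    -- Distributes degrees over edges: exchanging the sums and using `a-sym` turns the `toℕ j` part
    -- into the `toℕ i` part, so each yields `W`.
    sum-row-weights : ∑[ i < n ] ∑[ j < n ] (a i j * suc (toℕ i + toℕ j)) ≡ sum row + 2 * W
    sum-row-weights = begin
      ∑[ i < n ] ∑[ j < n ] (a i j * suc (toℕ i + toℕ j))
        ≡⟨ sum-cong-≗ (λ i → sum-cong-≗ (λ j → expand (a i j) (toℕ i) (toℕ j))) ⟩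
      ∑[ i < n ] ∑[ j < n ] (a i j + (toℕ i * a i j + toℕ j * a i j))
        ≡⟨ sum-cong-≗ (λ i → trans (∑-distrib-+ (a i) _)
             (cong (row i +_) (∑-distrib-+ (λ j → toℕ i * a i j) _))) ⟩
      ∑[ i < n ] (row i + (∑[ j < n ] (toℕ i * a i j) + ∑[ j < n ] (toℕ j * a i j)))
        ≡⟨ trans (∑-distrib-+ row _)
             (cong (sum row +_) (∑-distrib-+ (λ i → ∑[ j < n ] (toℕ i * a i j)) _)) ⟩
      sum row + (∑[ i < n ] ∑[ j < n ] (toℕ i * a i j) + ∑[ i < n ] ∑[ j < n ] (toℕ j * a i j))
        ≡⟨ cong₂ (λ x y → sum row + (x + y)) (sum-cong-≗ collect)
             (trans (∑-comm (λ i j → toℕ j * a i j))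
               (sum-cong-≗ (λ j → trans
                 (sum-cong-≗ (λ i → cong (toℕ j *_) (a-sym i j))) (collect j)))) ⟩
      sum row + (W + W)
        ≡⟨ cong (λ x → sum row + (W + x)) (+-identityʳ W) ⟨
      sum row + 2 * W ∎
      where
      open ≡-Reasoning
      expand : ∀ x i j → x * suc (i + j) ≡ x + (i * x + j * x)
      expand = (∀ x i j → x * (1 + (i + j)) ≡ x + (i * x + j * x)) ∋ solve-∀
      collect : ∀ i → ∑[ j < n ] (toℕ i * a i j) ≡ toℕ i * row i
      collect i = sym (*-distribˡ-sum (toℕ i) (a i))

    -- Summed from aᵢⱼ (n − 1 − i − j) ≤ (n − 1 − i − j)⁺; on the diagonal aᵢᵢ = 0, so
    -- the right-hand side exceeds by (n − 1 − 2i)⁺ there, whence diagonal-sum on the left.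
    sum-rows-≤ : n * sum row + diagonal-sum n ≤ sum row + 2 * W + square-sum n
    sum-rows-≤ = begin
      n * sum row + diagonal-sum n
        ≡⟨ cong (_+ diagonal-sum n) (trans (*-distribˡ-sum n row)
             (sum-cong-≗ (λ i → *-distribˡ-sum n (a i)))) ⟩
      ∑[ i < n ] ∑[ j < n ] (n * a i j) + diagonal-sum n
        ≡⟨ ∑-distrib-+ (λ i → ∑[ j < n ] (n * a i j)) _ ⟨
      ∑[ i < n ] (∑[ j < n ] (n * a i j) + (n ∸ suc (toℕ i + toℕ i)))
        ≤⟨ sum-mono-≤ (λ i → sum-mono-≤-gap i (on-diagonal i)
             (λ j → off-diagonal (a≤1 i j) (suc (toℕ i + toℕ j)))) ⟩
      ∑[ i < n ] ∑[ j < n ] (a i j * suc (toℕ i + toℕ j) + (n ∸ suc (toℕ i + toℕ j)))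
        ≡⟨ sum-cong-≗ (λ i → ∑-distrib-+ (λ j → a i j * suc (toℕ i + toℕ j)) _) ⟩
      ∑[ i < n ] (∑[ j < n ] (a i j * suc (toℕ i + toℕ j)) + ∑[ j < n ] (n ∸ suc (toℕ i + toℕ j)))
        ≡⟨ ∑-distrib-+ (λ i → ∑[ j < n ] (a i j * suc (toℕ i + toℕ j))) _ ⟩
      ∑[ i < n ] ∑[ j < n ] (a i j * suc (toℕ i + toℕ j)) + square-sum n
        ≡⟨ cong (_+ square-sum n) sum-row-weights ⟩
      sum row + 2 * W + square-sum n ∎
      where
      open ≤-Reasoning
      -- A subtraction-free form of `x (n − k) ≤ (n − k)⁺`; for `x = 1` it reads `n ≤ k + (n ∸ k)`.
      off-diagonal : ∀ {x} → x ≤ 1 → ∀ k → n * x ≤ x * k + (n ∸ k)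
      off-diagonal z≤n       k = ≤-trans (≤-reflexive (*-zeroʳ n)) z≤n
      off-diagonal (s≤s z≤n) k rewrite *-identityʳ n | +-identityʳ k = m≤n+m∸n n k
      on-diagonal : ∀ i → n * a i i + (n ∸ suc (toℕ i + toℕ i))
                        ≤ a i i * suc (toℕ i + toℕ i) + (n ∸ suc (toℕ i + toℕ i))
      on-diagonal i rewrite a-diag i | *-zeroʳ n = ≤-refl

    -- Eliminates `2 * (n * E)` between the identity for sorted sequences and twice `sum-rows-≤`;
    -- the common `4 * W + 2 * E` then cancels.
    sum-∣-∣-rows-≤ : Antitone row →
      ∑[ i < n ] ∑[ j < n ] ∣ row i - row j ∣ + 2 * diagonal-sum n ≤ 2 * square-sum n
    sum-∣-∣-rows-≤ anti = +-cancelʳ-≤ (4 * W + 2 * E) _ _ (begin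
      S + 2 * U + (4 * W + 2 * E)     ≡⟨ ((∀ S U W E →
        S + 2 * U + (4 * W + 2 * E) ≡ S + 4 * W + 2 * E + 2 * U) ∋ solve-∀) S U W E ⟩
      S + 4 * W + 2 * E + 2 * U       ≡⟨ cong (_+ 2 * U) (sum-∣-∣-antitone row anti) ⟩
      2 * (n * E) + 2 * U             ≡⟨ *-distribˡ-+ 2 (n * E) U ⟨
      2 * (n * E + U)                 ≤⟨ *-monoʳ-≤ 2 sum-rows-≤ ⟩
      2 * (E + 2 * W + T)             ≡⟨ ((∀ T W E →
        2 * (E + 2 * W + T) ≡ 2 * T + (4 * W + 2 * E)) ∋ solve-∀) T W E ⟩
      2 * T + (4 * W + 2 * E)         ∎)
      where
      open ≤-Reasoning
      S = ∑[ i < n ] ∑[ j < n ] ∣ row i - row j ∣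
      T = square-sum n
      U = diagonal-sum n
      E = sum row

  -- Evaluating the extremal sums.

  -- Twice a triangular number. Terms beyond index `k` vanish, so any length `m ≥ k` works; this
  -- matters because every row has `n` entries whatever its first weight.
  sum-∸ : ∀ {k m} → k ≤ m → 2 * ∑[ j < m ] (k ∸ toℕ j) ≡ k * suc k
  sum-∸ {zero}  {m}     z≤n       = cong (2 *_) (trans (sum-cong-≗ {m} (λ j → 0∸n≡0 (toℕ j))) (sum-replicate-zero m))
  sum-∸ {suc k} {suc m} (s≤s k≤m) = begin
    2 * (suc k + ∑[ j < m ] (k ∸ toℕ j))       ≡⟨ *-distribˡ-+ 2 (suc k) _ ⟩
    2 * suc k + 2 * ∑[ j < m ] (k ∸ toℕ j)     ≡⟨ cong (2 * suc k +_) (sum-∸ k≤m) ⟩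
    2 * suc k + k * suc k                      ≡⟨ *-distribʳ-+ (suc k) 2 k ⟨
    suc (suc k) * suc k                        ≡⟨ *-comm (2 + k) (suc k) ⟩
    suc k * suc (suc k)                        ∎
    where open ≡-Reasoning

  -- Telescopes: one more term adds `3n(n + 1) + 1 = (n + 1)³ − n³` to the left-hand side.
  sum-oblong : ∀ n → 3 * ∑[ i < n ] ((n ∸ suc (toℕ i)) * suc (n ∸ suc (toℕ i))) + n ≡ n ^ 3
  sum-oblong zero    = refl
  sum-oblong (suc n) = begin
    3 * (n * suc n + S) + suc n        ≡⟨ ((∀ n S →
      3 * (n * (1 + n) + S) + (1 + n) ≡ 3 * (n * (1 + n)) + 1 + (3 * S + n)) ∋ solve-∀) n S ⟩
    3 * (n * suc n) + 1 + (3 * S + n)  ≡⟨ cong (3 * (n * suc n) + 1 +_) (sum-oblong n) ⟩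
    3 * (n * suc n) + 1 + n ^ 3        ≡⟨ ((∀ n →
      3 * (n * (1 + n)) + 1 + n * (n * (n * 1)) ≡ (1 + n) * ((1 + n) * ((1 + n) * 1))) ∋ solve-∀) n ⟩
    suc n ^ 3                          ∎
    where
    open ≡-Reasoning
    S = ∑[ i < n ] ((n ∸ suc (toℕ i)) * suc (n ∸ suc (toℕ i)))

  -- Equivalently, `square-sum n` is `C(n+1, 3)`: row `i` counts down from `n ∸ suc i`, so its
  -- double is an oblong number.
  square-sum-value : ∀ n → 6 * square-sum n + n ≡ n ^ 3
  square-sum-value n = begin
    6 * square-sum n + n         ≡⟨ cong (_+ n) (*-assoc 3 2 (square-sum n)) ⟩
    3 * (2 * square-sum n) + n   ≡⟨ cong (λ x → 3 * x + n) (*-distribˡ-sum {n} 2 _) ⟩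
    3 * ∑[ i < n ] (2 * ∑[ j < n ] (n ∸ suc (toℕ i + toℕ j))) + n
      ≡⟨ cong (λ x → 3 * x + n) (sum-cong-≗ {n} λ i → trans
           (cong (2 *_) (sum-cong-≗ {n} λ j → sym (∸-+-assoc n (suc (toℕ i)) (toℕ j))))
           (sum-∸ (m∸n≤m n (suc (toℕ i))))) ⟩
    3 * ∑[ i < n ] ((n ∸ suc (toℕ i)) * suc (n ∸ suc (toℕ i))) + n
      ≡⟨ sum-oblong n ⟩
    n ^ 3                        ∎
    where open ≡-Reasoning

  -- The terms are `n − 1`, `n − 3`, and so on. Dropping the first lowers `n` by two but the length
  -- by one, hence a separate `m`. The `+ 1` covers odd `n`.
  diagonal-sum-bound : ∀ {n m} → n ≤ m → n ^ 2 ≤ 4 * ∑[ i < m ] (n ∸ suc (toℕ i + toℕ i)) + 1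
  diagonal-sum-bound {zero}                z≤n       = z≤n
  diagonal-sum-bound {suc zero}            (s≤s _)   = m≤n+m 1 _
  diagonal-sum-bound {suc (suc n)} {suc m} (s≤s n<m) = begin
    suc (suc n) ^ 2              ≡⟨ ((∀ n →
      (2 + n) * ((2 + n) * 1) ≡ 4 * (1 + n) + n * (n * 1)) ∋ solve-∀) n ⟩
    4 * suc n + n ^ 2            ≤⟨ +-monoʳ-≤ (4 * suc n) (diagonal-sum-bound (<⇒≤ n<m)) ⟩
    4 * suc n + (4 * V + 1)      ≡⟨ ((∀ n V →
      4 * (1 + n) + (4 * V + 1) ≡ 4 * ((1 + n) + V) + 1) ∋ solve-∀) n V ⟩
    4 * (suc n + V) + 1          ≡⟨ cong (λ x → 4 * (suc n + x) + 1) (sum-cong-≗ {m} λ i →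
      cong (n ∸_) (sym (+-suc (toℕ i) (toℕ i)))) ⟩
    4 * (suc n + ∑[ i < m ] (n ∸ (toℕ i + suc (toℕ i)))) + 1 ∎
    where
    open ≤-Reasoning
    V = ∑[ i < m ] (n ∸ suc (toℕ i + toℕ i))

  -- Application to the degrees of a graph.

  indicator : Bool → ℕ
  indicator b = if b then 1 else 0

  ∣tabulate∣ : ∀ {n} (b : Fin n → Bool) → ∣ tabulate b ∣ ≡ ∑[ i < n ] indicator (b i)
  ∣tabulate∣ {zero}  b = refl
  ∣tabulate∣ {suc n} b with b zero
  ... | true  = cong suc (∣tabulate∣ (b ∘ suc))
  ... | false = ∣tabulate∣ (b ∘ suc)

  degree-differences : ∀ {n} → Graph n → ℕ
  degree-differences {n} G = ∑[ u < n ] ∑[ v < n ] ∣ degree G u - degree G v ∣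

  -- Twelve times the theorem, with the negative terms moved to the left to stay in `ℕ`.
  degree-differences-bound : ∀ {n} (G : Graph n) →
    6 * degree-differences G + (3 * n ^ 2 + 2 * n) ≤ 2 * n ^ 3 + 3
  degree-differences-bound {n} G with sort (degree G)
  ... | π , anti = begin
    6 * degree-differences G + (3 * n ^ 2 + 2 * n)
      ≡⟨ cong (λ x → 6 * x + (3 * n ^ 2 + 2 * n)) relabel ⟩
    6 * S + (3 * n ^ 2 + 2 * n)
      -- Trades `3n²` for `12U + 3`, which supplies the `2 * U` needed beside `S`.
      ≤⟨ +-monoʳ-≤ (6 * S) (+-monoˡ-≤ (2 * n) (*-monoʳ-≤ 3 (diagonal-sum-bound {n} ≤-refl))) ⟩
    6 * S + (3 * (4 * U + 1) + 2 * n)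
      ≡⟨ ((∀ S U n → 6 * S + (3 * (4 * U + 1) + 2 * n)
            ≡ 6 * (S + 2 * U) + (2 * n + 3)) ∋ solve-∀) S U n ⟩
    6 * (S + 2 * U) + (2 * n + 3)
      ≤⟨ +-monoˡ-≤ (2 * n + 3) (*-monoʳ-≤ 6 (sum-∣-∣-rows-≤ a a≤1 a-sym a-diag
           (λ {i} {j} i≤j → subst₂ _≤_ (degree-π j) (degree-π i) (anti i≤j)))) ⟩
    6 * (2 * T) + (2 * n + 3)
      ≡⟨ ((∀ T n → 6 * (2 * T) + (2 * n + 3) ≡ 2 * (6 * T + n) + 3) ∋ solve-∀) T n ⟩
    2 * (6 * T + n) + 3
      ≡⟨ cong (λ x → 2 * x + 3) (square-sum-value n) ⟩
    2 * n ^ 3 + 3 ∎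
    where
    open ≤-Reasoning
    open Graph G using (adj?; irrefl) renaming (sym to adj-sym)
    a : Fin n → Fin n → ℕ
    -- Rows and columns are permuted alike, so symmetry and the zero diagonal persist.
    a i j = indicator (does (adj? (π ⟨$⟩ʳ i) (π ⟨$⟩ʳ j)))
    row : Fin n → ℕ
    row i = ∑[ j < n ] a i j
    S = ∑[ i < n ] ∑[ j < n ] ∣ row i - row j ∣
    T = square-sum n
    U = diagonal-sum n
    indicator≤1 : ∀ b → indicator b ≤ 1
    indicator≤1 true  = ≤-refl
    indicator≤1 false = z≤n
    a≤1 : ∀ i j → a i j ≤ 1
    a≤1 i j = indicator≤1 _
    a-sym : ∀ i j → a i j ≡ a j i
    a-sym i j = cong indicator (does-⇔ (mk⇔ adj-sym adj-sym) (adj? _ _) (adj? _ _))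
    a-diag : ∀ i → a i i ≡ 0
    a-diag i = cong indicator (dec-false (adj? _ _) (irrefl refl))
    degree-π : ∀ i → degree G (π ⟨$⟩ʳ i) ≡ row i
    degree-π i = trans (∣tabulate∣ {n} _) (sum-permute {n} _ π)
    relabel : degree-differences G ≡ S
    relabel = trans (sum-permute {n} _ π) (sum-cong-≗ {n} λ i →
      trans (sum-permute {n} _ π) (sum-cong-≗ {n} λ j → cong₂ ∣_-_∣ (degree-π i) (degree-π j)))

-- Transfer to the rationals.

open import Data.Integer.Base using (+_; _+_; _-_; _*_; _^_)
open import Data.Nat.Base using (ℕ)
open import Data.Rational.Base using (_≤_; _/_)

import Data.Integer.Base as ℤ
import Data.Integer.Properties as ℤ
open import Data.Integer.Tactic.RingSolver using (solve-∀)
import Data.Nat.Base as ℕ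
open import Function.Base using (_∋_)
open import Data.Rational.Base using (fromℚᵘ)
open import Data.Rational.Properties using (toℚᵘ-cancel-≤; toℚᵘ-fromℚᵘ)
import Data.Rational.Unnormalised.Base as ℚᵘ
import Data.Rational.Unnormalised.Properties as ℚᵘ
open import Relation.Binary.PropositionalEquality using (_≡_; refl; trans; cong; cong₂)

fromℚᵘ-mono-≤ : ∀ {p q} → p ℚᵘ.≤ q → fromℚᵘ p ≤ fromℚᵘ q
fromℚᵘ-mono-≤ {p} {q} p≤q = toℚᵘ-cancel-≤
  (ℚᵘ.≤-respˡ-≃ (ℚᵘ.≃-sym (toℚᵘ-fromℚᵘ p)) (ℚᵘ.≤-respʳ-≃ (ℚᵘ.≃-sym (toℚᵘ-fromℚᵘ q)) p≤q))

pos-^ : ∀ m k → + (m ℕ.^ k) ≡ (+ m) ^ k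
pos-^ m ℕ.zero    = refl
pos-^ m (ℕ.suc k) = trans (ℤ.pos-* m (m ℕ.^ k)) (cong (+ m *_) (pos-^ m k))

theorem2p1 : (n : ℕ) (G : Graph n) →
    irrₜ G ≤ (+ 2 * (+ n) ^ 3 - + 3 * (+ n) ^ 2 - + 2 * + n + + 3) / 12
-- `mkℚᵘ` stores the denominator minus one, so `1` and `11` encode 2 and 12. Unnormalised fractions
-- reduce the goal to cross multiplication.
theorem2p1 n G = fromℚᵘ-mono-≤ {ℚᵘ.mkℚᵘ (+ S) 1} {ℚᵘ.mkℚᵘ N 11} (ℚᵘ.*≤* S*12≤N*2)
  where
  open Counting using (degree-differences; degree-differences-bound)
  S = degree-differences G
  N = + 2 * (+ n) ^ 3 - + 3 * (+ n) ^ 2 - + 2 * + n + + 3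
  L = 6 ℕ.* S ℕ.+ (3 ℕ.* n ℕ.^ 2 ℕ.+ 2 ℕ.* n)
  R = 2 ℕ.* n ℕ.^ 3 ℕ.+ 3
  C = + 3 * (+ n) ^ 2 + + 2 * + n
  pos-L : + L ≡ + 6 * + S + C
  pos-L = trans (ℤ.pos-+ (6 ℕ.* S) _) (cong₂ _+_ (ℤ.pos-* 6 S)
    (trans (ℤ.pos-+ (3 ℕ.* n ℕ.^ 2) _) (cong₂ _+_
      (trans (ℤ.pos-* 3 (n ℕ.^ 2)) (cong (+ 3 *_) (pos-^ n 2))) (ℤ.pos-* 2 n))))
  pos-R : + R ≡ + 2 * (+ n) ^ 3 + + 3
  pos-R = trans (ℤ.pos-+ (2 ℕ.* n ℕ.^ 3) 3)
    (cong (_+ + 3) (trans (ℤ.pos-* 2 (n ℕ.^ 3)) (cong (+ 2 *_) (pos-^ n 3))))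
  S*12≤N*2 : + S * + 12 ℤ.≤ N * + 2
  S*12≤N*2 = begin
    -- Adding and subtracting `C` makes the cast of `L` appear, so the bound over `ℕ` applies.
    + S * + 12                              ≡⟨ ((∀ s c →
      s * + 12 ≡ (+ 6 * s + c - c) * + 2) ∋ solve-∀) (+ S) C ⟩
    (+ 6 * + S + C - C) * + 2               ≡⟨ cong (λ x → (x - C) * + 2) pos-L ⟨
    (+ L - C) * + 2                         ≤⟨ ℤ.*-monoʳ-≤-nonNeg (+ 2)
      (ℤ.+-monoˡ-≤ (ℤ.- C) (ℤ.+≤+ (degree-differences-bound G))) ⟩
    (+ R - C) * + 2                         ≡⟨ cong (λ x → (x - C) * + 2) pos-R ⟩
    (+ 2 * (+ n) ^ 3 + + 3 - C) * + 2       ≡⟨ ((∀ x y z →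
      (x + + 3 - (y + z)) * + 2 ≡ (x - y - z + + 3) * + 2) ∋ solve-∀)
      (+ 2 * (+ n) ^ 3) (+ 3 * (+ n) ^ 2) (+ 2 * + n) ⟩
    N * + 2                                 ∎
    where open ℤ.≤-Reasoning
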